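{- For every $\alpha\in(0,1)$, every set of $m$ statistical queries $\mathcal{Q}$ over a universe $U$ of size $N$ with query matrix $Q\in[0,1]^{m\times N}$, and every $n\in\mathbb{N}$, there exists \[ s=\frac5\alpha\cdot\mathrm{hdisc}^*(Q,n) \] such that for every dataset $x\in U^n$ whose elements are all distinct, there exists a dataset $y\in U^*$ of size at most $s$ with $\|\mathcal{Q}(x)-\mathcal{Q}(y)\|_\infty\le\alpha$.
   Context: A statistical query is $q:U\to\mathbb{R}$ with $q(x)=\frac1{|x|}\sum_{i}q(x_i)$ for a dataset $x$ (a finite sequence of elements of $U$); $\mathcal{Q}(x)=(q_1(x),\ldots,q_m(x))$; the query matrix has $i$-th row $(q_i(u))_{u\in U}$. $U^*$ denotes finite sequences over $U$. For an $m\times N$ matrix $Q$, $Q^*$ is the $(m+1)\times N$ matrix obtained by appending the all-ones row, $Q^*_S$ is its submatrix of columns in $S$, and $\mathrm{hdisc}^*(Q,w)=\max_{S\subseteq[N],|S|\le w}\min_{z\in\{\pm1\}^S}\|Q^*_Sz\|_\infty$. -}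

module Defs where

open import Algebra.Apartness.Bundles using (HeytingCommutativeRing; HeytingField)
open import Algebra.Bundles using (CommutativeRing)
import Algebra.Definitions.RawMonoid as RawMonoidDefs
open import Data.Fin using (Fin; zero; suc)
open import Data.Fin.Subset using (Subset; inside; outside; ∣_∣)
open import Data.List as List using (List; []; _∷_; length)
open import Data.Nat as ℕ using (ℕ; zero; suc)
open import Data.Product using (∃-syntax; _×_; proj₁)
open import Data.Sign using (Sign)
open import Data.Sum using (_⊎_; inj₁; inj₂)
open import Data.Vec as Vec using (Vec)
open import Data.Vec.Functional as Vector using (Vector)
open import Function using (_∘_; _⇔_; _↔_; Equivalence; Inverse)
import Level as L
open import Relation.Binary.Core using (Rel)
open import Relation.Binary.Definitions using (Cotransitive)
open import Relation.Binary.Lattice.Structures using (IsLattice)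
open import Relation.Binary.Structures using (IsStrictPartialOrder)
open import Relation.Nullary using (¬_)

-- The real numbers, characterised as a Cauchy-complete Archimedean ordered
-- field.  Classically this determines ℝ up to unique isomorphism.  The axioms
-- are the constructive ones (cotransitivity replaces trichotomy, and binary
-- maxima and minima are part of the structure), so that they also hold of the
-- Cauchy reals without excluded middle.

record Reals c ℓ₁ ℓ₂ ℓ₃ : Set (L.suc (c L.⊔ ℓ₁ L.⊔ ℓ₂ L.⊔ ℓ₃)) where
  infix  4 _<_ _≤_
  infixl 6 _⊔_
  infixl 7 _⊓_

  field
    heytingField : HeytingField c ℓ₁ ℓ₂

  open HeytingField heytingField public

  open CommutativeRing (HeytingCommutativeRing.commutativeRing heytingCommutativeRing) public
    using (+-rawMonoid)

  open RawMonoidDefs +-rawMonoid public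
    using (sum) renaming (_×_ to _·_)

  field
    _<_ : Rel Carrier ℓ₃
    _⊔_ : Carrier → Carrier → Carrier
    _⊓_ : Carrier → Carrier → Carrier

  _≤_ : Rel Carrier ℓ₃
  x ≤ y = ¬ (y < x)

  abs : Carrier → Carrier
  abs x = x ⊔ (- x)

  fromℕ : ℕ → Carrier
  fromℕ n = n · 1#

  field
    <-isStrictPartialOrder : IsStrictPartialOrder _≈_ _<_
    <-cotrans              : Cotransitive _<_
    #⇔<⊎>                  : ∀ {x y} → x # y ⇔ (x < y ⊎ y < x)
    0<1                    : 0# < 1#
    +-monoˡ-<              : ∀ z {x y} → x < y → x + z < y + z
    *-pos                  : ∀ {x y} → 0# < x → 0# < y → 0# < x * y
    ≤-isLattice            : IsLattice _≈_ _≤_ _⊔_ _⊓_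
    archimedean            : ∀ x → ∃[ n ] x < fromℕ n

  -- The tolerance is 1 / (k + 1), cleared of its denominator.
  IsCauchy : (ℕ → Carrier) → Set ℓ₃
  IsCauchy a = ∀ k → ∃[ M ] ∀ i j → M ℕ.≤ i → M ℕ.≤ j →
                 fromℕ (suc k) * abs (a i - a j) ≤ 1#

  _⟶_ : (ℕ → Carrier) → Carrier → Set ℓ₃
  a ⟶ l = ∀ k → ∃[ M ] ∀ i → M ℕ.≤ i →
                 fromℕ (suc k) * abs (a i - l) ≤ 1#

  field
    complete : ∀ a → IsCauchy a → ∃[ l ] a ⟶ l

-- The columns of a matrix picked out by S, in increasing order.
columns : ∀ {N} (S : Subset N) → Fin ∣ S ∣ → Fin N
columns (inside  Vec.∷ S) zero    = zero
columns (inside  Vec.∷ S) (suc j) = suc (columns S j)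
columns (outside Vec.∷ S) j       = suc (columns S j)

subsets : ∀ N → List (Subset N)
subsets zero    = Vec.[] ∷ []
subsets (suc N) = List.map (outside Vec.∷_) (subsets N)
           List.++ List.map (inside Vec.∷_) (subsets N)

module OverReals {c ℓ₁ ℓ₂ ℓ₃} (ℝ : Reals c ℓ₁ ℓ₂ ℓ₃) where
  open Reals ℝ

  -- The library's invertibility axiom is about differences x - y with x # y;
  -- here it is used at x - 0#.
  recip : ∀ x → 0# < x → Carrier
  recip x 0<x = proj₁ (#⇒invertible (Equivalence.from #⇔<⊎> (inj₂ 0<x)))

  0<fromℕ-suc : ∀ n → 0# < fromℕ (suc n)
  0<fromℕ-suc zero    = <-respʳ-≈ (sym (+-identityʳ 1#)) 0<1
    where open IsStrictPartialOrder <-isStrictPartialOrder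
  0<fromℕ-suc (suc n) =
    SPO.trans (0<fromℕ-suc n)
      (SPO.<-respˡ-≈ (+-identityˡ _) (+-monoˡ-< (fromℕ (suc n)) 0<1))
    where module SPO = IsStrictPartialOrder <-isStrictPartialOrder

  ∥_∥∞ : ∀ {k} → Vector Carrier k → Carrier
  ∥ v ∥∞ = Vector.foldr _⊔_ 0# (abs ∘ v)

  Matrix : ℕ → ℕ → Set c
  Matrix m N = Fin m → Fin N → Carrier

  infix 10 _*ones
  _*ones : ∀ {m N} → Matrix m N → Matrix (m ℕ.+ 1) N
  Q *ones = Q Vector.++ (λ (_ : Fin 1) _ → 1#)

  submatrix : ∀ {m N} → Matrix m N → (S : Subset N) → Matrix m ∣ S ∣
  submatrix A S i j = A i (columns S j)

  signed : Sign → Carrier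
  signed Sign.+ = 1#
  signed Sign.- = - 1#

  applySigns : ∀ {m k} → Matrix m k → Vec Sign k → Vector Carrier m
  applySigns A z i = sum (λ j → A i j * signed (Vec.lookup z j))

  minSigns : ∀ k → (Vec Sign k → Carrier) → Carrier
  minSigns zero    f = f Vec.[]
  minSigns (suc k) f = minSigns k (f ∘ (Sign.+ Vec.∷_)) ⊓ minSigns k (f ∘ (Sign.- Vec.∷_))

  disc : ∀ {m k} → Matrix m k → Carrier
  disc {k = k} A = minSigns k (λ z → ∥ applySigns A z ∥∞)

  -- Starting the maximum at 0# is harmless: S = ∅ always qualifies and
  -- contributes 0#.
  hdisc* : ∀ {m N} → Matrix m N → ℕ → Carrier
  hdisc* {N = N} Q w =
    List.foldr _⊔_ 0#
      (List.map (λ S → disc (submatrix (Q *ones) S))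
        (List.filter (λ S → ∣ S ∣ ℕ.≤? w) (subsets N)))

  module _ {u} {U : Set u} where

    queryMatrix : ∀ {m N} → Fin N ↔ U → (Fin m → U → Carrier) → Matrix m N
    queryMatrix enum q i j = q i (Inverse.to enum j)

    -- The mean over the empty dataset is 0 / 0, set to 0# by convention.
    mean : (U → Carrier) → List U → Carrier
    mean f []         = 0#
    mean f xs@(_ ∷ t) =
      recip (fromℕ (length xs)) (0<fromℕ-suc (length t)) * List.foldr _+_ 0# (List.map f xs)

    answers : ∀ {m} → (Fin m → U → Carrier) → List U → Vector Carrier m
    answers q xs i = mean (q i) xs

    error : ∀ {m} → (Fin m → U → Carrier) → List U → List U → Carrier
    error q xs ys = ∥ (λ i → answers q xs i - answers q ys i) ∥∞

{-# OPTIONS --safe #-}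
module Submission where

-- A ±1 colouring z of the columns S with ∥ Q*_S z ∥∞ ≤ e splits S so that
-- twice the sum of each query over the positive part T is within e of its sum
-- over S, and 2 ∣T∣ is within e of ∣S∣ because of the all-ones row.  After k
-- halvings, 2 ^ k times the sums and the size are within (2 ^ k - 1) e of the
-- original ones, so the means are within 2 e / ∣T∣ of each other.
-- Constructively neither an optimal colouring nor a test of ∣S∣ ≤ 5 h / α,
-- where h = hdisc*, is available.  But h ≥ 1 and α < 1 give some e > h with
-- (4 + α) e < 5 h, so colourings with discrepancy below e can be found, and
-- cotransitivity decides between α ∣S∣ < 5 h (stop) and (4 + α) e < α ∣S∣
-- (halve once more: then ∣T∣ ≥ 2 e / α, so the error stays below α).

open import Defs
open import Algebra.Bundles using (CommutativeRing)
open import Algebra.Apartness.Bundles using (HeytingCommutativeRing)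
import Algebra.Properties.AbelianGroup as AbelianGroupProperties
import Algebra.Properties.Ring as RingProperties
import Algebra.Solver.Ring.NaturalCoefficients.Default as SemiringSolver
open import Data.Empty using (⊥-elim)
open import Data.Fin using (Fin; zero; suc; _↑ˡ_; _↑ʳ_)
open import Data.Fin.Subset using (Subset; inside; outside; ∣_∣; ⁅_⁆) renaming (⊥ to ∅)
import Data.Fin.Subset.Properties as Subset
open import Data.List as List using (List; []; _∷_; length)
open import Data.List.Membership.Propositional using (_∈_)
import Data.List.Membership.Propositional.Properties as ∈
import Data.List.Properties as List
open import Data.List.Relation.Unary.Any using (here; there)
open import Data.Nat as ℕ using (ℕ; zero; suc)
open import Data.Nat.Induction using (Acc; acc; <-wellFounded)
import Data.Nat.Properties as ℕ
open import Data.Product using (∃-syntax; _×_; _,_; proj₁; proj₂)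
open import Data.Sign using (Sign)
open import Data.Sum using (_⊎_; inj₁; inj₂; [_,_]′)
open import Data.Vec as Vec using (Vec; toList; _[_]≔_; lookup)
import Data.Vec.Functional.Properties as Vector
import Data.Vec.Properties as Vec
open import Data.Vec.Relation.Unary.All using (All; []; _∷_)
open import Data.Vec.Relation.Unary.Unique.Propositional using (Unique; []; _∷_)
open import Function using (_↔_; _∘_; id; Inverse; Equivalence)
import Level as L
open import Relation.Binary.Lattice.Structures using (IsLattice)
open import Relation.Binary.Definitions using (Trans)
open import Relation.Binary.PropositionalEquality as ≡ using (_≡_; _≢_)
import Relation.Binary.Reasoning.Base.Triple as Triple
open import Relation.Binary.Structures using (IsStrictPartialOrder; IsPartialOrder)

-- Order and arithmetic in a constructive ordered field.

module OrderedField {c ℓ₁ ℓ₂ ℓ₃} (ℝ : Reals c ℓ₁ ℓ₂ ℓ₃) where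
  open Reals ℝ hiding (zero)

  ringℝ : CommutativeRing c ℓ₁
  ringℝ = HeytingCommutativeRing.commutativeRing heytingCommutativeRing

  open CommutativeRing ringℝ using (commutativeSemiring; ring; +-abelianGroup)
  open SemiringSolver commutativeSemiring public
    using (Polynomial; solve; _:+_; _:*_; _:=_; con)
  open AbelianGroupProperties +-abelianGroup public
    using (⁻¹-anti-homo‿-) renaming (⁻¹-involutive to -‿involutive)
  open RingProperties ring using (-1*x≈-x)

  open IsStrictPartialOrder <-isStrictPartialOrder
    using (<-resp-≈) renaming (trans to <-trans; asym to <-asym; irrefl to <-irrefl)
  open IsLattice ≤-isLattice using (supremum; infimum; isPartialOrder)
  open IsPartialOrder isPartialOrder public
    using () renaming (isPreorder to ≤-isPreorder; trans to ≤-trans;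
                       antisym to ≤-antisym; reflexive to ≤-reflexive)

  ≤-refl : ∀ {x} → x ≤ x
  ≤-refl = ≤-reflexive refl

  <⇒≤ : ∀ {x y} → x < y → x ≤ y
  <⇒≤ = <-asym

  -- As `≤` is a negated `<`, cotransitivity at the third point yields either the goal or a
  -- contradiction.
  <-≤-trans : Trans _<_ _≤_ _<_
  <-≤-trans {j = y} {k = z} x<y y≤z = [ id , ⊥-elim ∘ y≤z ]′ (<-cotrans x<y z)

  ≤-<-trans : Trans _≤_ _<_ _<_
  ≤-<-trans {i = x} x≤y y<z = [ ⊥-elim ∘ x≤y , id ]′ (<-cotrans y<z x)

  module ≤-Reasoning =
    Triple ≤-isPreorder <-asym <-trans <-resp-≈ <⇒≤ <-≤-trans ≤-<-trans

  open ≤-Reasoning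

  +-cancelʳ-< : ∀ z {x y} → x + z < y + z → x < y
  +-cancelʳ-< z {x} {y} x+z<y+z = begin-strict
    x               ≈⟨ [x+z]-z≈x x ⟨
    (x + z) + (- z) <⟨ +-monoˡ-< (- z) x+z<y+z ⟩
    (y + z) + (- z) ≈⟨ [x+z]-z≈x y ⟩
    y               ∎
    where
    [x+z]-z≈x : ∀ x → (x + z) + (- z) ≈ x
    [x+z]-z≈x x = trans (+-assoc x z (- z)) (trans (+-congˡ (-‿inverseʳ z)) (+-identityʳ x))

  +-cancelʳ-≤ : ∀ z {x y} → x + z ≤ y + z → x ≤ y
  +-cancelʳ-≤ z x+z≤y+z = x+z≤y+z ∘ +-monoˡ-< z

  +-monoˡ-≤ : ∀ z {x y} → x ≤ y → x + z ≤ y + z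
  +-monoˡ-≤ z x≤y = x≤y ∘ +-cancelʳ-< z

  +-mono-≤ : ∀ {x y u v} → x ≤ y → u ≤ v → x + u ≤ y + v
  +-mono-≤ {x} {y} {u} {v} x≤y u≤v = begin
    x + u ≤⟨ +-monoˡ-≤ u x≤y ⟩
    y + u ≈⟨ +-comm y u ⟩
    u + y ≤⟨ +-monoˡ-≤ y u≤v ⟩
    v + y ≈⟨ +-comm v y ⟩
    y + v ∎

  0≤x+y : ∀ {x y} → 0# ≤ x → 0# ≤ y → 0# ≤ x + y
  0≤x+y 0≤x 0≤y = ≤-trans (≤-reflexive (sym (+-identityˡ 0#))) (+-mono-≤ 0≤x 0≤y)

  x≤x+y : ∀ {x y} → 0# ≤ y → x ≤ x + y
  x≤x+y {x} {y} 0≤y = begin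
    x      ≈⟨ +-identityʳ x ⟨
    x + 0# ≤⟨ +-mono-≤ ≤-refl 0≤y ⟩
    x + y  ∎

  [x-y]+y≈x : ∀ x y → (x - y) + y ≈ x
  [x-y]+y≈x x y = trans (+-assoc x (- y) y) (trans (+-congˡ (-‿inverseˡ y)) (+-identityʳ x))

  x<y⇒0<y-x : ∀ {x y} → x < y → 0# < y - x
  x<y⇒0<y-x {x} {y} x<y = +-cancelʳ-< x (begin-strict
    0# + x      ≈⟨ +-identityˡ x ⟩
    x           <⟨ x<y ⟩
    y           ≈⟨ [x-y]+y≈x y x ⟨
    (y - x) + x ∎)

  *-monoʳ-< : ∀ {z x y} → 0# < z → x < y → z * x < z * y
  *-monoʳ-< {z} {x} {y} 0<z x<y = begin-strict
    z * x               ≈⟨ +-identityˡ (z * x) ⟨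
    0# + z * x          <⟨ +-monoˡ-< (z * x) (*-pos 0<z (x<y⇒0<y-x x<y)) ⟩
    z * (y - x) + z * x ≈⟨ distribˡ z (y - x) x ⟨
    z * ((y - x) + x)   ≈⟨ *-congˡ ([x-y]+y≈x y x) ⟩
    z * y               ∎

  *-cancelˡ-≤ : ∀ {z x y} → 0# < z → z * x ≤ z * y → x ≤ y
  *-cancelˡ-≤ 0<z zx≤zy = zx≤zy ∘ *-monoʳ-< 0<z

  -- Inequalities are negative, so by tightness of # it is enough to
  -- refute z * y < z * x in the cases x < y and x ≈ y.
  *-monoʳ-≤-pos : ∀ {z x y} → 0# < z → x ≤ y → z * x ≤ z * y
  *-monoʳ-≤-pos {z} {x} {y} 0<z x≤y zy<zx = <-irrefl (*-congˡ (sym x≈y)) zy<zx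
    where
    x≈y : x ≈ y
    x≈y = proj₁ (tight x y) λ x#y →
      [ (λ x<y → <-asym (*-monoʳ-< 0<z x<y) zy<zx) , x≤y ]′ (Equivalence.to #⇔<⊎> x#y)

  -- Whether `z` is positive or zero cannot be decided. A violation refutes `0# < z` by the positive
  -- case, so `z ≈ 0#` by antisymmetry, and then both products vanish.
  *-monoʳ-≤ : ∀ {z x y} → 0# ≤ z → x ≤ y → z * x ≤ z * y
  *-monoʳ-≤ {z} {x} {y} 0≤z x≤y zy<zx = <-irrefl zy≈zx zy<zx
    where
    z≈0 : z ≈ 0#
    z≈0 = ≤-antisym (λ 0<z → *-monoʳ-≤-pos 0<z x≤y zy<zx) 0≤z
    zy≈zx : z * y ≈ z * x
    zy≈zx = trans (*-congʳ z≈0) (trans (zeroˡ y) (sym (trans (*-congʳ z≈0) (zeroˡ x))))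

  *-monoˡ-≤ : ∀ {z x y} → 0# ≤ z → x ≤ y → x * z ≤ y * z
  *-monoˡ-≤ {z} {x} {y} 0≤z x≤y = begin
    x * z ≈⟨ *-comm x z ⟩
    z * x ≤⟨ *-monoʳ-≤ 0≤z x≤y ⟩
    z * y ≈⟨ *-comm z y ⟩
    y * z ∎

  0≤x*y : ∀ {x y} → 0# ≤ x → 0# ≤ y → 0# ≤ x * y
  0≤x*y {x} 0≤x 0≤y = ≤-trans (≤-reflexive (sym (zeroʳ x))) (*-monoʳ-≤ 0≤x 0≤y)

  0≤1 : 0# ≤ 1#
  0≤1 = <⇒≤ 0<1

  x≤x⊔y : ∀ {x y} → x ≤ x ⊔ y
  x≤x⊔y {x} {y} = proj₁ (supremum x y)

  y≤x⊔y : ∀ {x y} → y ≤ x ⊔ y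
  y≤x⊔y {x} {y} = proj₁ (proj₂ (supremum x y))

  ⊔-least : ∀ {x y z} → x ≤ z → y ≤ z → x ⊔ y ≤ z
  ⊔-least {x} {y} {z} = proj₂ (proj₂ (supremum x y)) z

  ⊓-greatest : ∀ {x y z} → z ≤ x → z ≤ y → z ≤ x ⊓ y
  ⊓-greatest {x} {y} {z} = proj₂ (proj₂ (infimum x y)) z

  -- The minimum need not equal either argument. Cotransitivity gives `x < z` or `x ⊓ y < x`, and in
  -- the latter case `y` is bounded by the minimum.
  ⊓-selective-< : ∀ {x y z} → x ⊓ y < z → x < z ⊎ y < z
  ⊓-selective-< {x} {y} {z} x⊓y<z with <-cotrans x⊓y<z x
  ... | inj₂ x<z   = inj₁ x<z
  ... | inj₁ x⊓y<x = inj₂ (≤-<-trans y≤x⊓y x⊓y<z)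
    where
    y≤x⊓y : y ≤ x ⊓ y
    -- If also `x ⊓ y < y`, then `y < x` would make `y` a lower bound of both and hence at most the
    -- minimum. So `x ≤ y`, and `x` itself is at most the minimum, contrary to `x ⊓ y < x`.
    y≤x⊓y x⊓y<y = ⊓-greatest ≤-refl (λ y<x → ⊓-greatest (<⇒≤ y<x) ≤-refl x⊓y<y) x⊓y<x

  0≤fromℕ : ∀ n → 0# ≤ fromℕ n
  0≤fromℕ zero    = ≤-refl
  0≤fromℕ (suc n) = 0≤x+y 0≤1 (0≤fromℕ n)

  fromℕ-mono-≤ : ∀ {m n} → m ℕ.≤ n → fromℕ m ≤ fromℕ n
  fromℕ-mono-≤ {n = n} ℕ.z≤n = 0≤fromℕ n
  fromℕ-mono-≤ (ℕ.s≤s m≤n)   = +-mono-≤ ≤-refl (fromℕ-mono-≤ m≤n)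

  -- Evaluates to fromℕ k definitionally, unlike con k.
  nat : ∀ {n} → ℕ → Polynomial n
  nat zero    = con 0
  nat (suc k) = con 1 :+ nat k

  -- |x - y| ≤ e, with no subtraction so that the semiring solver applies.
  Near : Carrier → Carrier → Carrier → Set ℓ₃
  Near e x y = x ≤ y + e × y ≤ x + e

  Near-resp-≈ : ∀ {e x x′ y y′} → x ≈ x′ → y ≈ y′ → Near e x y → Near e x′ y′
  Near-resp-≈ {e} {x} {x′} {y} {y′} x≈x′ y≈y′ (x≤y+e , y≤x+e) =
    (begin x′ ≈⟨ x≈x′ ⟨ x ≤⟨ x≤y+e ⟩ y + e ≈⟨ +-congʳ y≈y′ ⟩ y′ + e ∎) ,
    (begin y′ ≈⟨ y≈y′ ⟨ y ≤⟨ y≤x+e ⟩ x + e ≈⟨ +-congʳ x≈x′ ⟩ x′ + e ∎)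

  Near⇒abs≤ : ∀ {e x y} → Near e x y → abs (x - y) ≤ e
  Near⇒abs≤ {e} (x≤y+e , y≤x+e) =
    ⊔-least (x-y≤e x≤y+e) (≤-trans (≤-reflexive (⁻¹-anti-homo‿- _ _)) (x-y≤e y≤x+e))
    where
    x-y≤e : ∀ {x y} → x ≤ y + e → x - y ≤ e
    x-y≤e {x} {y} x≤y+e = +-cancelʳ-≤ y (begin
      (x - y) + y ≈⟨ [x-y]+y≈x x y ⟩
      x           ≤⟨ x≤y+e ⟩
      y + e       ≈⟨ +-comm y e ⟩
      e + y       ∎)

  abs≤⇒Near : ∀ {e x y d} → x ≈ y + d → abs d ≤ e → Near e x y
  abs≤⇒Near {e} {x} {y} {d} x≈y+d |d|≤e =
    (begin
      x     ≈⟨ x≈y+d ⟩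
      y + d ≤⟨ +-mono-≤ ≤-refl (≤-trans x≤x⊔y |d|≤e) ⟩
      y + e ∎) ,
    (begin
      y             ≈⟨ +-identityʳ y ⟨
      y + 0#        ≈⟨ +-congˡ (-‿inverseʳ d) ⟨
      y + (d + - d) ≈⟨ +-assoc y d (- d) ⟨
      (y + d) + - d ≤⟨ +-mono-≤ (≤-reflexive (sym x≈y+d)) (≤-trans y≤x⊔y |d|≤e) ⟩
      x + e         ∎)

  x+x*-1≈0 : ∀ x → x + x * (- 1#) ≈ 0#
  x+x*-1≈0 x = trans (+-congˡ (trans (*-comm x (- 1#)) (-1*x≈-x x))) (-‿inverseʳ x)

  x+x≤y+y⇒x≤y : ∀ {x y} → x + x ≤ y + y → x ≤ y
  x+x≤y+y⇒x≤y {x} {y} 2x≤2y y<x = 2x≤2y (begin-strict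
    y + y <⟨ +-monoˡ-< y y<x ⟩
    x + y ≈⟨ +-comm x y ⟩
    y + x <⟨ +-monoˡ-< x y<x ⟩
    x + x ∎)

  x*y≤x : ∀ {x y} → 0# ≤ x → y ≤ 1# → x * y ≤ x
  x*y≤x {x} 0≤x y≤1 = ≤-trans (*-monoʳ-≤ 0≤x y≤1) (≤-reflexive (*-identityʳ x))

  -- The error recursion for one more halving: `1 + p′` is twice `1 + p`, and the new error `e`,
  -- scaled by `1 + p`, joins the accumulated `p * e` to make `(1 + 2p) * e`.
  Near-double : ∀ {p e x y z} → 0# ≤ p → Near e (x + x) y → Near (p * e) ((1# + p) * y) z →
                let p′ = 1# + (p + p) in Near (p′ * e) ((1# + p′) * x) z
  Near-double {p} {e} {x} {y} {z} 0≤p (2x≤y+e , y≤2x+e) (py≤z+pe , z≤py+pe) =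
    (begin
      (1# + (1# + (p + p))) * x         ≈⟨ solve 2 (λ p x → (con 1 :+ (con 1 :+ (p :+ p))) :* x := (con 1 :+ p) :* (x :+ x)) refl p x ⟩
      (1# + p) * (x + x)                ≤⟨ *-monoʳ-≤ 0≤1+p 2x≤y+e ⟩
      (1# + p) * (y + e)                ≈⟨ distribˡ _ y e ⟩
      (1# + p) * y + (1# + p) * e       ≤⟨ +-monoˡ-≤ _ py≤z+pe ⟩
      (z + p * e) + (1# + p) * e        ≈⟨ solve 3 (λ p z e → (z :+ p :* e) :+ (con 1 :+ p) :* e := z :+ (con 1 :+ (p :+ p)) :* e) refl p z e ⟩
      z + (1# + (p + p)) * e            ∎) ,
    (begin
      z                                 ≤⟨ z≤py+pe ⟩
      (1# + p) * y + p * e              ≤⟨ +-monoˡ-≤ _ (*-monoʳ-≤ 0≤1+p y≤2x+e) ⟩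
      (1# + p) * ((x + x) + e) + p * e  ≈⟨ solve 3 (λ p x e → (con 1 :+ p) :* ((x :+ x) :+ e) :+ p :* e := (con 1 :+ (con 1 :+ (p :+ p))) :* x :+ (con 1 :+ (p :+ p)) :* e) refl p x e ⟩
      (1# + (1# + (p + p))) * x + (1# + (p + p)) * e ∎)
    where
    0≤1+p : 0# ≤ 1# + p
    0≤1+p = 0≤x+y 0≤1 0≤p

  -- Perturbing numerator and denominator of a ratio a ∈ [0, 1] by e each, to
  -- w * b and w, changes the ratio by at most 2e / w.
  Near-ratio : ∀ {α e w n a b} → 0# ≤ e → 0# < w → a ≤ 1# → 0# ≤ a → e + e ≤ α * w →
               Near e (w * b) (n * a) → Near e w n → Near α a b
  Near-ratio {α} {e} {w} {n} {a} {b} 0≤e 0<w a≤1 0≤a 2e≤αw (wb≤na+e , na≤wb+e) (w≤n+e , n≤w+e) =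
    *-cancelˡ-≤ 0<w (begin
      w * a               ≤⟨ *-monoˡ-≤ 0≤a w≤n+e ⟩
      (n + e) * a         ≈⟨ distribʳ a n e ⟩
      n * a + e * a       ≤⟨ +-mono-≤ na≤wb+e (x*y≤x 0≤e a≤1) ⟩
      (w * b + e) + e     ≤⟨ add-α ⟩
      w * (b + α)         ∎) ,
    *-cancelˡ-≤ 0<w (begin
      w * b               ≤⟨ wb≤na+e ⟩
      n * a + e           ≤⟨ +-monoˡ-≤ e (*-monoˡ-≤ 0≤a n≤w+e) ⟩
      (w + e) * a + e     ≈⟨ +-congʳ (distribʳ a w e) ⟩
      (w * a + e * a) + e ≤⟨ +-monoˡ-≤ e (+-mono-≤ ≤-refl (x*y≤x 0≤e a≤1)) ⟩
      (w * a + e) + e     ≤⟨ add-α ⟩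
      w * (a + α)         ∎)
    where
    add-α : ∀ {x} → (w * x + e) + e ≤ w * (x + α)
    add-α {x} = begin
      (w * x + e) + e ≈⟨ +-assoc _ e e ⟩
      w * x + (e + e) ≤⟨ +-mono-≤ ≤-refl 2e≤αw ⟩
      w * x + α * w   ≈⟨ solve 3 (λ w x α → w :* x :+ α :* w := w :* (x :+ α)) refl w x α ⟩
      w * (x + α)     ∎

-- Subsets of columns and their correspondence with datasets.

∈-subsets : ∀ {N} (S : Subset N) → S ∈ subsets N
∈-subsets Vec.[] = here ≡.refl
∈-subsets (outside Vec.∷ S) = ∈.∈-++⁺ˡ (∈.∈-map⁺ _ (∈-subsets S))
∈-subsets {suc N} (inside Vec.∷ S) =
  ∈.∈-++⁺ʳ (List.map (outside Vec.∷_) (subsets N)) (∈.∈-map⁺ _ (∈-subsets S))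

positives : ∀ {N} (S : Subset N) → Vec Sign ∣ S ∣ → Subset N
positives Vec.[]             z                = Vec.[]
positives (inside  Vec.∷ S) (Sign.+ Vec.∷ z) = inside Vec.∷ positives S z
positives (inside  Vec.∷ S) (Sign.- Vec.∷ z) = outside Vec.∷ positives S z
positives (outside Vec.∷ S) z                = outside Vec.∷ positives S z

∣insert∣ : ∀ {N} (S : Subset N) i → lookup S i ≡ outside → ∣ S [ i ]≔ inside ∣ ≡ suc ∣ S ∣
∣insert∣ (outside Vec.∷ S) zero    i∉S = ≡.refl
∣insert∣ (inside  Vec.∷ S) (suc i) i∉S = ≡.cong suc (∣insert∣ S i i∉S)
∣insert∣ (outside Vec.∷ S) (suc i) i∉S = ∣insert∣ S i i∉S

module _ {u} {U : Set u} {N} (enum : Fin N ↔ U) where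
  open Inverse enum using (to; from; strictlyInverseˡ)

  -- Repeated elements collapse here; distinctness of the dataset is what makes sizes and sums agree
  -- with those of the set of columns.
  support : ∀ {n} → Vec U n → Subset N
  support Vec.[]       = ∅
  support (x Vec.∷ xs) = support xs [ from x ]≔ inside

  support-fresh : ∀ {n} {x} (xs : Vec U n) → All (x ≢_) xs →
                  lookup (support xs) (from x) ≡ outside
  support-fresh {x = x} Vec.[]       []            = Vec.lookup-replicate (from x) outside
  support-fresh {x = x} (y Vec.∷ ys) (x≢y ∷ x∉ys) =
    ≡.trans (Vec.lookup∘update′ from-x≢from-y (support ys) inside) (support-fresh ys x∉ys)
    where
    from-x≢from-y : from x ≢ from y
    from-x≢from-y eq =
      x≢y (≡.trans (≡.sym (strictlyInverseˡ x)) (≡.trans (≡.cong to eq) (strictlyInverseˡ y)))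

  ∣support∣ : ∀ {n} {xs : Vec U n} → Unique xs → ∣ support xs ∣ ≡ n
  ∣support∣ []                             = Subset.∣⊥∣≡0 N
  ∣support∣ {xs = x Vec.∷ xs} (x∉xs ∷ uniq) =
    ≡.trans (∣insert∣ (support xs) (from x) (support-fresh xs x∉xs))
            (≡.cong suc (∣support∣ uniq))

  members : Subset N → List U
  members S = List.tabulate (to ∘ columns S)

-- Norms, discrepancy and its hereditary maximum.

module Discrepancy {c ℓ₁ ℓ₂ ℓ₃} (ℝ : Reals c ℓ₁ ℓ₂ ℓ₃) where
  open Reals ℝ hiding (zero)
  open OverReals ℝ
  open OrderedField ℝ
  open ≤-Reasoning

  ∥∥∞-entry : ∀ {k} (v : Fin k → Carrier) i → abs (v i) ≤ ∥ v ∥∞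
  ∥∥∞-entry v zero    = x≤x⊔y
  ∥∥∞-entry v (suc i) = ≤-trans (∥∥∞-entry (v ∘ suc) i) y≤x⊔y

  ∥∥∞-least : ∀ {k} (v : Fin k → Carrier) {e} → 0# ≤ e → (∀ i → abs (v i) ≤ e) → ∥ v ∥∞ ≤ e
  ∥∥∞-least {zero}  v 0≤e v≤e = 0≤e
  ∥∥∞-least {suc k} v 0≤e v≤e = ⊔-least (v≤e zero) (∥∥∞-least (v ∘ suc) 0≤e (v≤e ∘ suc))

  -- A constructive minimum need not be attained, but it is approximated from above.
  minSigns-witness : ∀ k (f : Vec Sign k → Carrier) {e} → minSigns k f < e → ∃[ z ] f z < e
  minSigns-witness zero    f min<e = Vec.[] , min<e
  minSigns-witness (suc k) f min<e with ⊓-selective-< min<e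
  ... | inj₁ min₊<e = let z , fz<e = minSigns-witness k _ min₊<e in Sign.+ Vec.∷ z , fz<e
  ... | inj₂ min₋<e = let z , fz<e = minSigns-witness k _ min₋<e in Sign.- Vec.∷ z , fz<e

  ⊔-foldr-upper : ∀ {a} {A : Set a} (f : A → Carrier) {x xs} → x ∈ xs →
                  f x ≤ List.foldr _⊔_ 0# (List.map f xs)
  ⊔-foldr-upper f (here ≡.refl) = x≤x⊔y
  ⊔-foldr-upper f (there x∈xs)  = ≤-trans (⊔-foldr-upper f x∈xs) y≤x⊔y

  ⊔-foldr-nonneg : ∀ xs → 0# ≤ List.foldr _⊔_ 0# xs
  ⊔-foldr-nonneg []       = ≤-refl
  ⊔-foldr-nonneg (x ∷ xs) = ≤-trans (⊔-foldr-nonneg xs) y≤x⊔y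

  0≤hdisc* : ∀ {m N} (Q : Matrix m N) w → 0# ≤ hdisc* Q w
  0≤hdisc* {N = N} Q w =
    ⊔-foldr-nonneg (List.map (λ S → disc (submatrix (Q *ones) S))
      (List.filter (λ S → ∣ S ∣ ℕ.≤? w) (subsets N)))

  disc≤hdisc* : ∀ {m N} (Q : Matrix m N) {w} (S : Subset N) → ∣ S ∣ ℕ.≤ w →
                disc (submatrix (Q *ones) S) ≤ hdisc* Q w
  disc≤hdisc* Q {w} S ∣S∣≤w =
    ⊔-foldr-upper (λ S → disc (submatrix (Q *ones) S))
      (∈.∈-filter⁺ (λ S → ∣ S ∣ ℕ.≤? w) (∈-subsets S) ∣S∣≤w)

  *ones-row : ∀ {m N} (Q : Matrix m N) i → (Q *ones) (i ↑ˡ 1) ≡ Q i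
  *ones-row Q i = Vector.lookup-++ˡ Q _ i

  *ones-last : ∀ {m N} (Q : Matrix m N) → (Q *ones) (m ↑ʳ zero) ≡ (λ _ → 1#)
  *ones-last Q = Vector.lookup-++ʳ Q (λ (_ : Fin 1) _ → 1#) zero

  -- With one column, a row of ones evaluates to 1 or -1 under either sign. The width is given by an
  -- equation because the size of a singleton is 1 only propositionally.
  1≤disc-column : ∀ {m k} (A : Matrix m k) i → k ≡ 1 → (∀ j → A i j ≡ 1#) → 1# ≤ disc A
  1≤disc-column A i ≡.refl Ai≡1 =
    ⊓-greatest
      (≤-trans (≤-trans (≤-reflexive (sym (entry Sign.+))) x≤x⊔y) (∥∥∞-entry _ i))
      (≤-trans (≤-trans (≤-reflexive 1≈-entry) y≤x⊔y) (∥∥∞-entry _ i))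
    where
    entry : ∀ s → A i zero * signed s + 0# ≈ signed s
    entry s = trans (+-identityʳ _) (trans (*-congʳ (reflexive (Ai≡1 zero))) (*-identityˡ _))
    1≈-entry : 1# ≈ - (A i zero * (- 1#) + 0#)
    1≈-entry = sym (trans (-‿cong (entry Sign.-)) (-‿involutive 1#))

  -- A single column already has discrepancy at least 1, thanks to the appended row of ones.
  1≤hdisc* : ∀ {m N} (Q : Matrix m N) {w} → Fin N → 1 ℕ.≤ w → 1# ≤ hdisc* Q w
  1≤hdisc* {m} Q j 1≤w =
    ≤-trans
      (1≤disc-column (submatrix (Q *ones) ⁅ j ⁆) (m ↑ʳ zero) (Subset.∣⁅x⁆∣≡1 j)
        (λ i → ≡.cong-app (*ones-last Q) (columns ⁅ j ⁆ i)))
      (disc≤hdisc* Q ⁅ j ⁆ (≡.subst (ℕ._≤ _) (≡.sym (Subset.∣⁅x⁆∣≡1 j)) 1≤w))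

  -- Sums over sets of columns and the halving step.

  Σ[_] : ∀ {N} → Subset N → (Fin N → Carrier) → Carrier
  Σ[ S ] g = sum (g ∘ columns S)

  Σ-⊥ : ∀ {N} (g : Fin N → Carrier) → Σ[ ∅ ] g ≈ 0#
  Σ-⊥ {zero}  g = refl
  Σ-⊥ {suc N} g = Σ-⊥ (g ∘ suc)

  Σ-insert : ∀ {N} (g : Fin N → Carrier) S i → lookup S i ≡ outside →
             Σ[ S [ i ]≔ inside ] g ≈ g i + Σ[ S ] g
  Σ-insert g (outside Vec.∷ S) zero    i∉S = refl
  Σ-insert g (outside Vec.∷ S) (suc i) i∉S = Σ-insert (g ∘ suc) S i i∉S
  Σ-insert g (inside  Vec.∷ S) (suc i) i∉S =
    trans (+-congˡ (Σ-insert (g ∘ suc) S i i∉S))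
      (solve 3 (λ a b s → a :+ (b :+ s) := b :+ (a :+ s)) refl _ _ _)

  -- The factor `1 + z j` is 2 on the positive columns and 0 on the negative ones.
  Σ-positives : ∀ {N} (g : Fin N → Carrier) S z →
                let T = positives S z in
                Σ[ T ] g + Σ[ T ] g ≈
                Σ[ S ] g + sum (λ j → g (columns S j) * signed (lookup z j))
  Σ-positives g Vec.[] z = refl
  Σ-positives g (outside Vec.∷ S) z = Σ-positives (g ∘ suc) S z
  Σ-positives g (inside Vec.∷ S) (Sign.+ Vec.∷ z) = begin-equality
    (g zero + t) + (g zero + t)       ≈⟨ solve 2 (λ a t → (a :+ t) :+ (a :+ t) := (a :+ a) :+ (t :+ t)) refl _ t ⟩
    (g zero + g zero) + (t + t)       ≈⟨ +-congˡ (Σ-positives (g ∘ suc) S z) ⟩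
    (g zero + g zero) + (s + w)       ≈⟨ solve 3 (λ a s w → (a :+ a) :+ (s :+ w) := (a :+ s) :+ (a :* con 1 :+ w)) refl _ s w ⟩
    (g zero + s) + (g zero * 1# + w)  ∎
    where
    t = Σ[ positives S z ] (g ∘ suc)
    s = Σ[ S ] (g ∘ suc)
    w = sum (λ j → g (suc (columns S j)) * signed (lookup z j))
  Σ-positives g (inside Vec.∷ S) (Sign.- Vec.∷ z) = begin-equality
    t + t                                     ≈⟨ Σ-positives (g ∘ suc) S z ⟩
    s + w                                     ≈⟨ +-identityˡ _ ⟨
    0# + (s + w)                              ≈⟨ +-congʳ (x+x*-1≈0 (g zero)) ⟨
    (g zero + g zero * (- 1#)) + (s + w)      ≈⟨ solve 4 (λ a b s w → (a :+ b) :+ (s :+ w) := (a :+ s) :+ (b :+ w)) refl (g zero) (g zero * (- 1#)) s w ⟩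
    (g zero + s) + (g zero * (- 1#) + w)      ∎
    where
    t = Σ[ positives S z ] (g ∘ suc)
    s = Σ[ S ] (g ∘ suc)
    w = sum (λ j → g (suc (columns S j)) * signed (lookup z j))

  Σ-one : ∀ {N} (S : Subset N) → Σ[ S ] (λ _ → 1#) ≈ fromℕ ∣ S ∣
  Σ-one S = sum-one ∣ S ∣
    where
    sum-one : ∀ k → sum {k} (λ _ → 1#) ≈ fromℕ k
    sum-one zero    = refl
    sum-one (suc k) = +-congˡ (sum-one k)

  Σ-nonneg : ∀ {N} {g : Fin N → Carrier} S → (∀ j → 0# ≤ g j) → 0# ≤ Σ[ S ] g
  Σ-nonneg S 0≤g = sum-nonneg ∣ S ∣ (0≤g ∘ columns S)
    where
    sum-nonneg : ∀ k {g : Fin k → Carrier} → (∀ j → 0# ≤ g j) → 0# ≤ sum g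
    sum-nonneg zero    0≤g = ≤-refl
    sum-nonneg (suc k) 0≤g = 0≤x+y (0≤g zero) (sum-nonneg k (0≤g ∘ suc))

  Σ≤∣_∣ : ∀ {N} (S : Subset N) {g : Fin N → Carrier} → (∀ j → g j ≤ 1#) → Σ[ S ] g ≤ fromℕ ∣ S ∣
  Σ≤∣ S ∣ g≤1 = sum≤ ∣ S ∣ (g≤1 ∘ columns S)
    where
    sum≤ : ∀ k {g : Fin k → Carrier} → (∀ j → g j ≤ 1#) → sum g ≤ fromℕ k
    sum≤ zero    g≤1 = ≤-refl
    sum≤ (suc k) g≤1 = +-mono-≤ (g≤1 zero) (sum≤ k (g≤1 ∘ suc))

  -- The signed sum in `Σ-positives` is exactly entry `i` of the coloured matrix, so the norm bounds
  -- the errors of all rows at once.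
  halving : ∀ {m N} (A : Matrix m N) (S : Subset N) {e} → disc (submatrix A S) < e →
            ∃[ T ] ∀ i → Near e (Σ[ T ] (A i) + Σ[ T ] (A i)) (Σ[ S ] (A i))
  halving A S disc<e with minSigns-witness ∣ S ∣ _ disc<e
  ... | z , norm<e = positives S z , λ i →
    abs≤⇒Near (Σ-positives (A i) S z) (≤-trans (∥∥∞-entry _ i) (<⇒≤ norm<e))

  -- Reciprocals and means.

  recip-inverseʳ : ∀ x (0<x : 0# < x) → x * recip x 0<x ≈ 1#
  recip-inverseʳ x 0<x with #⇒invertible (Equivalence.from (#⇔<⊎> {x} {0#}) (inj₂ 0<x))
  ... | _ , _ , x-0*r≈1 = trans (*-congʳ x≈x-0) x-0*r≈1
    where
    x≈x-0 : x ≈ x - 0#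
    x≈x-0 = trans (sym ([x-y]+y≈x x 0#)) (+-identityʳ _)

  -- Being invertible, the reciprocal is apart from zero; were it negative, its product with `x`,
  -- which is 1, would be negative too.
  recip-pos : ∀ x (0<x : 0# < x) → 0# < recip x 0<x
  recip-pos x 0<x with Equivalence.to #⇔<⊎> (invertible⇒# (x , x*[r-0]≈1 , [r-0]*x≈1))
    where
    r = recip x 0<x
    r-0≈r : r - 0# ≈ r
    r-0≈r = trans (sym (+-identityʳ _)) ([x-y]+y≈x r 0#)
    x*[r-0]≈1 : x * (r - 0#) ≈ 1#
    x*[r-0]≈1 = trans (*-congˡ r-0≈r) (recip-inverseʳ x 0<x)
    [r-0]*x≈1 : (r - 0#) * x ≈ 1#
    [r-0]*x≈1 = trans (*-comm _ _) x*[r-0]≈1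
  ... | inj₂ 0<r = 0<r
  ... | inj₁ r<0 = ⊥-elim (0≤1 (begin-strict
    1#              ≈⟨ recip-inverseʳ x 0<x ⟨
    x * recip x 0<x <⟨ *-monoʳ-< 0<x r<0 ⟩
    x * 0#          ≈⟨ zeroʳ x ⟩
    0#              ∎))

  module _ {u} {U : Set u} where

    listSum : (U → Carrier) → List U → Carrier
    listSum f xs = List.foldr _+_ 0# (List.map f xs)

    -- Cleared of its denominator, the identity also covers the empty list, where both sides are
    -- zero.
    length*mean : ∀ f (xs : List U) → fromℕ (length xs) * mean f xs ≈ listSum f xs
    length*mean f []           = zeroˡ 0#
    length*mean f xs@(_ ∷ t) =
      trans (sym (*-assoc _ _ _))
        (trans (*-congʳ (recip-inverseʳ _ (0<fromℕ-suc (length t)))) (*-identityˡ _))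

    listSum-tabulate : ∀ f {k} (g : Fin k → U) → listSum f (List.tabulate g) ≈ sum (f ∘ g)
    listSum-tabulate f {zero}  g = refl
    listSum-tabulate f {suc k} g = +-congˡ (listSum-tabulate f (g ∘ suc))

    module _ {N} (enum : Fin N ↔ U) where
      open Inverse enum using (to; from; strictlyInverseˡ)

      listSum-members : ∀ f S → listSum f (members enum S) ≈ Σ[ S ] (f ∘ to)
      listSum-members f S = listSum-tabulate f (to ∘ columns S)

      listSum-support : ∀ f {n} {xs : Vec U n} → Unique xs →
                        listSum f (toList xs) ≈ Σ[ support enum xs ] (f ∘ to)
      listSum-support f []                               = sym (Σ-⊥ (f ∘ to))
      listSum-support f {xs = x Vec.∷ xs} (x∉xs ∷ uniq) = begin-equality
        f x + listSum f (toList xs)                  ≈⟨ +-cong (reflexive (≡.cong f (≡.sym (strictlyInverseˡ x)))) (listSum-support f uniq) ⟩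
        f (to (from x)) + Σ[ support enum xs ] (f ∘ to) ≈⟨ Σ-insert (f ∘ to) (support enum xs) (from x) (support-fresh enum xs x∉xs) ⟨
        Σ[ support enum (x Vec.∷ xs) ] (f ∘ to)      ∎

-- Iterated halving with error control.

module Reduction {c ℓ₁ ℓ₂ ℓ₃} (ℝ : Reals c ℓ₁ ℓ₂ ℓ₃)
  {α : Reals.Carrier ℝ} (0<α : Reals._<_ ℝ (Reals.0# ℝ) α) (α<1 : Reals._<_ ℝ α (Reals.1# ℝ))
  where

  open Reals ℝ
  open OverReals ℝ
  open OrderedField ℝ
  open Discrepancy ℝ
  open ≤-Reasoning

  -- The witness is e = h + (1 - α) / 5.
  slack : ∀ {h} → 1# ≤ h → ∃[ e ] h < e × (fromℕ 4 + α) * e < fromℕ 5 * h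
  slack {h} 1≤h = h + ε , h<h+ε , +-cancelʳ-< (δ * (h + ε)) (begin-strict
    -- Since `4 + α + δ = 5` and `5 * ε = δ`, adding `δ * (h + ε)` turns the left side into
    -- `5 * h + δ`. The inequality `1 ≤ h` then gives `δ ≤ δ * h < δ * (h + ε)`.
    (fromℕ 4 + α) * (h + ε) + δ * (h + ε) ≈⟨ solve 4 (λ f α δ e → (f :+ α) :* e :+ δ :* e := (f :+ (δ :+ α)) :* e) refl (fromℕ 4) α δ (h + ε) ⟩
    (fromℕ 4 + (δ + α)) * (h + ε)         ≈⟨ *-congʳ (+-congˡ ([x-y]+y≈x 1# α)) ⟩
    (fromℕ 4 + 1#) * (h + ε)              ≈⟨ *-congʳ (+-comm (fromℕ 4) 1#) ⟩
    fromℕ 5 * (h + ε)                     ≈⟨ distribˡ (fromℕ 5) h ε ⟩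
    fromℕ 5 * h + fromℕ 5 * ε             ≈⟨ +-congˡ 5ε≈δ ⟩
    fromℕ 5 * h + δ                       ≈⟨ +-congˡ (*-identityʳ δ) ⟨
    fromℕ 5 * h + δ * 1#                  ≤⟨ +-mono-≤ ≤-refl (*-monoʳ-≤ (<⇒≤ 0<δ) 1≤h) ⟩
    fromℕ 5 * h + δ * h                   ≈⟨ +-comm _ _ ⟩
    δ * h + fromℕ 5 * h                   <⟨ +-monoˡ-< _ (*-monoʳ-< 0<δ h<h+ε) ⟩
    δ * (h + ε) + fromℕ 5 * h             ≈⟨ +-comm _ _ ⟩
    fromℕ 5 * h + δ * (h + ε)             ∎)
    where
    0<5 = 0<fromℕ-suc 4
    δ = 1# - α
    ε = recip (fromℕ 5) 0<5 * δ
    0<δ : 0# < δ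
    0<δ = x<y⇒0<y-x α<1
    5ε≈δ : fromℕ 5 * ε ≈ δ
    5ε≈δ = trans (sym (*-assoc _ _ δ)) (trans (*-congʳ (recip-inverseʳ _ 0<5)) (*-identityˡ δ))
    h<h+ε : h < h + ε
    h<h+ε = begin-strict
      h      ≈⟨ +-identityˡ h ⟨
      0# + h <⟨ +-monoˡ-< h (*-pos (recip-pos _ 0<5) 0<δ) ⟩
      ε + h  ≈⟨ +-comm ε h ⟩
      h + ε  ∎

  module _ {m N} (A : Matrix m N) (o : Fin m) (Ao≡1 : A o ≡ (λ _ → 1#))
           {e} (0<e : 0# < e) (S₀ : Subset N) where

    -- The row `o` is the row of ones, so the closeness of row sums also controls the number of
    -- columns.
    Σ-ones : ∀ S → Σ[ S ] (A o) ≈ fromℕ ∣ S ∣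
    Σ-ones S = trans (reflexive (≡.cong Σ[ S ] Ao≡1)) (Σ-one S)

    -- After k halvings, 1 + p = 2 ^ k.
    record Approximates (S : Subset N) : Set (c L.⊔ ℓ₃) where
      field
        p     : Carrier
        0≤p   : 0# ≤ p
        near  : ∀ i → Near (p * e) ((1# + p) * Σ[ S ] (A i)) (Σ[ S₀ ] (A i))
        -- This is the premise of `Near-ratio` for the error `p * e` and the weight
        -- `(1 + p) * ∣ S ∣`.
        small : p * e + p * e ≤ α * ((1# + p) * fromℕ ∣ S ∣)

    Halves : Subset N → Subset N → Set _
    Halves T S = ∀ i → Near e (Σ[ T ] (A i) + Σ[ T ] (A i)) (Σ[ S ] (A i))

    approximates-refl : Approximates S₀
    approximates-refl = record
      { p     = 0#
      ; 0≤p   = ≤-refl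
      ; near  = λ i →
          ≤-reflexive (solve 2 (λ s e → (con 1 :+ con 0) :* s := s :+ con 0 :* e) refl _ e) ,
          ≤-reflexive (solve 2 (λ s e → s := (con 1 :+ con 0) :* s :+ con 0 :* e) refl _ e)
      ; small = ≤-trans
          (≤-reflexive (solve 1 (λ e → con 0 :* e :+ con 0 :* e := con 0) refl e))
          (0≤x*y (<⇒≤ 0<α) (0≤x*y (0≤x+y 0≤1 ≤-refl) (0≤fromℕ ∣ S₀ ∣)))
      }

    module _ S T (T½S : Halves T S) (big : (fromℕ 4 + α) * e < α * fromℕ ∣ S ∣) where
      private
        s t : Carrier
        s = fromℕ ∣ S ∣
        t = fromℕ ∣ T ∣

        2t≈s : Near e (t + t) s
        2t≈s = Near-resp-≈ (+-cong (Σ-ones T) (Σ-ones T)) (Σ-ones S) (T½S o)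

      -- Halving gives `2 * t ≥ s - e`, so `2 * α * t ≥ α * s - α * e > 4 * e`. The extra `α` in the
      -- threshold `4 + α` absorbs the rounding loss `α * e`.
      halves-lower : e + e ≤ α * t
      halves-lower = x+x≤y+y⇒x≤y (+-cancelʳ-≤ (α * e) (begin
        ((e + e) + (e + e)) + α * e ≈⟨ solve 2 (λ α e → ((e :+ e) :+ (e :+ e)) :+ α :* e := (nat 4 :+ α) :* e) refl α e ⟩
        (fromℕ 4 + α) * e           <⟨ big ⟩
        α * s                       ≤⟨ *-monoʳ-≤ (<⇒≤ 0<α) (proj₂ 2t≈s) ⟩
        α * ((t + t) + e)           ≈⟨ solve 3 (λ α t e → α :* ((t :+ t) :+ e) := (α :* t :+ α :* t) :+ α :* e) refl α t e ⟩
        (α * t + α * t) + α * e     ∎))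

      -- Ensures termination: `∣ S ∣ ≤ ∣ T ∣` would give `2 * s ≤ 2 * t ≤ s + e`, hence `s ≤ e`,
      -- whereas `big` and `α < 1` force `e < s`.
      halves-smaller : ∣ T ∣ ℕ.< ∣ S ∣
      halves-smaller = ℕ.≰⇒> λ ∣S∣≤∣T∣ → +-cancelʳ-≤ s (begin
        s + s ≤⟨ +-mono-≤ (fromℕ-mono-≤ ∣S∣≤∣T∣) (fromℕ-mono-≤ ∣S∣≤∣T∣) ⟩
        t + t ≤⟨ proj₁ 2t≈s ⟩
        s + e ≈⟨ +-comm s e ⟩
        e + s ∎) e<s
        where
        e<s : e < s
        e<s = begin-strict
          e                             ≤⟨ x≤x+y (0≤x*y (0≤x+y (0≤fromℕ 3) (<⇒≤ 0<α)) (<⇒≤ 0<e)) ⟩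
          e + (fromℕ 3 + α) * e         ≈⟨ solve 2 (λ α e → e :+ (nat 3 :+ α) :* e := (nat 4 :+ α) :* e) refl α e ⟩
          (fromℕ 4 + α) * e             <⟨ big ⟩
          α * s                         ≈⟨ *-comm α s ⟩
          s * α                         ≤⟨ x*y≤x (0≤fromℕ ∣ S ∣) (<⇒≤ α<1) ⟩
          s                             ∎

      halves-nonempty : 0 ℕ.< ∣ T ∣
      halves-nonempty = ℕ.n≢0⇒n>0 λ ∣T∣≡0 → (begin
        e      ≤⟨ x≤x+y (<⇒≤ 0<e) ⟩
        e + e  ≤⟨ halves-lower ⟩
        α * t  ≈⟨ *-congˡ (reflexive (≡.cong fromℕ ∣T∣≡0)) ⟩
        α * 0# ≈⟨ zeroʳ α ⟩
        0#     ∎) 0<e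

      halves-approximates : Approximates S → Approximates T
      halves-approximates S≈S₀ = record
        { p     = p′
        ; 0≤p   = 0≤p′
        ; near  = λ i → Near-double 0≤p (T½S i) (near i)
        -- Scaling `halves-lower` by `p′` bounds the error by `p′ * α * t`; one further `α * t`
        -- completes the weight `1 + p′`.
        ; small = begin
            p′ * e + p′ * e       ≈⟨ distribˡ p′ e e ⟨
            p′ * (e + e)          ≤⟨ *-monoʳ-≤ 0≤p′ halves-lower ⟩
            p′ * (α * t)          ≤⟨ x≤x+y (0≤x*y (<⇒≤ 0<α) (0≤fromℕ ∣ T ∣)) ⟩
            p′ * (α * t) + α * t  ≈⟨ solve 3 (λ p α t → p :* (α :* t) :+ α :* t := α :* ((con 1 :+ p) :* t)) refl p′ α t ⟩
            α * ((1# + p′) * t)   ∎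
        }
        where
        open Approximates S≈S₀
        p′ = 1# + (p + p)
        0≤p′ : 0# ≤ p′
        0≤p′ = 0≤x+y 0≤1 (0≤x+y 0≤p 0≤p)

    -- Well-founded recursion on the number of columns. The bound by `∣ S₀ ∣` is carried along
    -- because colourings are available only for sets of at most that size.
    reduce : ∀ {r} → (fromℕ 4 + α) * e < r →
             (∀ S → ∣ S ∣ ℕ.≤ ∣ S₀ ∣ → ∃[ T ] Halves T S) → 0 ℕ.< ∣ S₀ ∣ →
             ∃[ T ] 0 ℕ.< ∣ T ∣ × α * fromℕ ∣ T ∣ ≤ r × Approximates T
    reduce {r} 4e+αe<r halve S₀≢∅ = go S₀ (<-wellFounded _) S₀≢∅ ℕ.≤-refl approximates-refl
      where
      go : ∀ S → Acc ℕ._<_ ∣ S ∣ → 0 ℕ.< ∣ S ∣ → ∣ S ∣ ℕ.≤ ∣ S₀ ∣ → Approximates S →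
           ∃[ T ] 0 ℕ.< ∣ T ∣ × α * fromℕ ∣ T ∣ ≤ r × Approximates T
      -- The two outcomes overlap when `α * ∣ S ∣` lies strictly between `(4 + α) * e` and `r`;
      -- stopping and halving are both sound there.
      go S (acc rec) S≢∅ ∣S∣≤∣S₀∣ S≈S₀ with <-cotrans 4e+αe<r (α * fromℕ ∣ S ∣)
      ... | inj₂ α∣S∣<r = S , S≢∅ , <⇒≤ α∣S∣<r , S≈S₀
      ... | inj₁ big with halve S ∣S∣≤∣S₀∣
      ...   | T , T½S =
        go T (rec ∣T∣<∣S∣) (halves-nonempty S T T½S big)
           (ℕ.≤-trans (ℕ.<⇒≤ ∣T∣<∣S∣) ∣S∣≤∣S₀∣) (halves-approximates S T T½S big S≈S₀)
        where
        ∣T∣<∣S∣ = halves-smaller S T T½S big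

-- From the reduced set of columns to the small dataset.

theorem6p8 : ∀ {c ℓ₁ ℓ₂ ℓ₃ u} (ℝ : Reals c ℓ₁ ℓ₂ ℓ₃) →
    let open Reals ℝ
        open OverReals ℝ
    in
    (α : Carrier) (0<α : 0# < α) → α < 1# →
    (m N : ℕ) (U : Set u) (enum : Fin N ↔ U) (q : Fin m → U → Carrier) →
    (∀ i j → 0# ≤ queryMatrix enum q i j × queryMatrix enum q i j ≤ 1#) →
    (n : ℕ) →
    ∃[ s ] (s ≈ (fromℕ 5 * recip α 0<α) * hdisc* (queryMatrix enum q) n) ×
      ((x : Vec U n) → Unique x →
        ∃[ y ] (fromℕ (length y) ≤ s) ×
               -- the answers on y are genuine averages unless x itself is empty
               (y ≡ [] → n ≡ 0) ×
               (error q (toList x) y ≤ α))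
theorem6p8 ℝ α 0<α α<1 m N U enum q 0≤q≤1 n = s n , refl , dataset n
  where
  open Reals ℝ hiding (zero)
  open OverReals ℝ
  open OrderedField ℝ
  open Discrepancy ℝ
  open Reduction ℝ 0<α α<1
  open ≤-Reasoning
  open Inverse enum using (from)

  Q : Matrix m N
  Q = queryMatrix enum q

  s : ℕ → Carrier
  s n = (fromℕ 5 * recip α 0<α) * hdisc* Q n

  ≤s : ∀ n {k} → α * k ≤ fromℕ 5 * hdisc* Q n → k ≤ s n
  ≤s n {k} αk≤5h = *-cancelˡ-≤ 0<α (begin
    α * k                                      ≤⟨ αk≤5h ⟩
    fromℕ 5 * hdisc* Q n                       ≈⟨ *-identityˡ _ ⟨
    1# * (fromℕ 5 * hdisc* Q n)                ≈⟨ *-congʳ (recip-inverseʳ α 0<α) ⟨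
    (α * recip α 0<α) * (fromℕ 5 * hdisc* Q n) ≈⟨ solve 4 (λ α f r h → (α :* r) :* (f :* h) := α :* ((f :* r) :* h)) refl α _ _ _ ⟩
    α * s n                                    ∎)

  dataset : ∀ n (x : Vec U n) → Unique x →
            ∃[ y ] fromℕ (length y) ≤ s n × (y ≡ [] → n ≡ 0) × error q (toList x) y ≤ α
  -- The bound `1 ≤ h` requires `n` to be positive, so the empty dataset is treated apart: it is its
  -- own approximation, both answers being the default `0#`.
  dataset zero Vec.[] _ =
    [] ,
    ≤s 0 (≤-trans (≤-reflexive (zeroʳ α)) (0≤x*y (0≤fromℕ 5) (0≤hdisc* Q 0))) ,
    (λ _ → ≡.refl) ,
    ∥∥∞-least (λ i → answers q [] i - answers q [] i) (<⇒≤ 0<α)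
      λ _ → Near⇒abs≤ (x≤x+y (<⇒≤ 0<α) , x≤x+y (<⇒≤ 0<α))
  dataset n@(suc n-1) x@(u Vec.∷ _) uniq =
    y ,
    ≡.subst (λ k → fromℕ k ≤ s n) (≡.sym ∣y∣≡∣T∣) (≤s n α∣T∣≤5h) ,
    (λ y≡[] → ⊥-elim (ℕ.<⇒≢ T≢∅ (≡.trans (≡.cong length (≡.sym y≡[])) ∣y∣≡∣T∣))) ,
    ∥∥∞-least _ (<⇒≤ 0<α) (λ i → Near⇒abs≤ (near-mean i))
    where
    S₀ = support enum x

    ∣S₀∣≡n : ∣ S₀ ∣ ≡ n
    ∣S₀∣≡n = ∣support∣ enum uniq

    -- The first element of `x` supplies the column for the singleton.
    1≤h = 1≤hdisc* Q {n} (from u) (ℕ.s≤s ℕ.z≤n)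
    e   = proj₁ (slack 1≤h)
    h<e = proj₁ (proj₂ (slack 1≤h))

    0<e : 0# < e
    0<e = ≤-<-trans (≤-trans 0≤1 1≤h) h<e

    -- Here `r` is `5 * h`, so the stopping condition becomes the required size bound after division
    -- by `α`.
    reduced = reduce (Q *ones) (m ↑ʳ zero) (*ones-last Q) 0<e S₀ (proj₂ (proj₂ (slack 1≤h)))
      (λ S ∣S∣≤∣S₀∣ → halving (Q *ones) S
        (≤-<-trans (disc≤hdisc* Q S (≡.subst (∣ S ∣ ℕ.≤_) ∣S₀∣≡n ∣S∣≤∣S₀∣)) h<e))
      (≡.subst (0 ℕ.<_) (≡.sym ∣S₀∣≡n) (ℕ.s≤s ℕ.z≤n))
    T       = proj₁ reduced
    T≢∅     = proj₁ (proj₂ reduced)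
    α∣T∣≤5h = proj₁ (proj₂ (proj₂ reduced))
    open Approximates (proj₂ (proj₂ (proj₂ reduced)))

    y : List U
    y = members enum T

    ∣y∣≡∣T∣ : length y ≡ ∣ T ∣
    ∣y∣≡∣T∣ = List.length-tabulate _

    w : Carrier
    w = (1# + p) * fromℕ ∣ T ∣

    0<w : 0# < w
    0<w = *-pos (<-≤-trans 0<1 (x≤x+y 0≤p)) (0<fromℕ∣T∣ T≢∅)
      where
      0<fromℕ∣T∣ : ∀ {k} → 0 ℕ.< k → 0# < fromℕ k
      0<fromℕ∣T∣ {suc k} _ = 0<fromℕ-suc k

    near-size : Near (p * e) w (fromℕ n)
    near-size = Near-resp-≈
      -- The row of ones compares `2 ^ k` times the size of `T` with `n`, that is, the denominators
      -- of the two means.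
      (*-congˡ (ones T)) (trans (ones S₀) (reflexive (≡.cong fromℕ ∣S₀∣≡n))) (near (m ↑ʳ zero))
      where ones = Σ-ones (Q *ones) (m ↑ʳ zero) (*ones-last Q) 0<e S₀

    Σ-x : ∀ i → fromℕ n * mean (q i) (toList x) ≈ Σ[ S₀ ] (Q i)
    Σ-x i = begin-equality
      fromℕ n * mean (q i) (toList x)                   ≈⟨ *-congʳ (reflexive (≡.cong fromℕ (Vec.length-toList x))) ⟨
      fromℕ (length (toList x)) * mean (q i) (toList x) ≈⟨ length*mean (q i) (toList x) ⟩
      listSum (q i) (toList x)                          ≈⟨ listSum-support enum (q i) uniq ⟩
      Σ[ S₀ ] (Q i)                                     ∎

    Σ-y : ∀ i → fromℕ ∣ T ∣ * mean (q i) y ≈ Σ[ T ] (Q i)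
    Σ-y i = begin-equality
      fromℕ ∣ T ∣ * mean (q i) y    ≈⟨ *-congʳ (reflexive (≡.cong fromℕ ∣y∣≡∣T∣)) ⟨
      fromℕ (length y) * mean (q i) y ≈⟨ length*mean (q i) y ⟩
      listSum (q i) y               ≈⟨ listSum-members enum (q i) T ⟩
      Σ[ T ] (Q i)                  ∎

    near-sum : ∀ i → Near (p * e) (w * mean (q i) y) (fromℕ n * mean (q i) (toList x))
    near-sum i = Near-resp-≈
      (begin-equality
        (1# + p) * Σ[ T ] ((Q *ones) (i ↑ˡ 1))   ≈⟨ *-congˡ (row T) ⟩
        (1# + p) * Σ[ T ] (Q i)                  ≈⟨ *-congˡ (Σ-y i) ⟨
        (1# + p) * (fromℕ ∣ T ∣ * mean (q i) y)  ≈⟨ *-assoc _ _ _ ⟨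
        w * mean (q i) y                         ∎)
      (trans (row S₀) (sym (Σ-x i)))
      (near (i ↑ˡ 1))
      where
      row : ∀ S → Σ[ S ] ((Q *ones) (i ↑ˡ 1)) ≈ Σ[ S ] (Q i)
      row S = reflexive (≡.cong Σ[ S ] (*ones-row Q i))

    0<n : 0# < fromℕ n
    0<n = 0<fromℕ-suc n-1

    near-mean : ∀ i → Near α (mean (q i) (toList x)) (mean (q i) y)
    -- The ratio known to lie in `[0, 1]` is the mean over `x`, and its two bounds are checked after
    -- multiplication by `n`.
    near-mean i = Near-ratio (0≤x*y 0≤p (<⇒≤ 0<e)) 0<w
      (*-cancelˡ-≤ 0<n (begin
        fromℕ n * mean (q i) (toList x) ≈⟨ Σ-x i ⟩
        Σ[ S₀ ] (Q i)                   ≤⟨ Σ≤∣ S₀ ∣ (λ j → proj₂ (0≤q≤1 i j)) ⟩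
        fromℕ ∣ S₀ ∣                    ≈⟨ reflexive (≡.cong fromℕ ∣S₀∣≡n) ⟩
        fromℕ n                         ≈⟨ *-identityʳ _ ⟨
        fromℕ n * 1#                    ∎))
      (*-cancelˡ-≤ 0<n (begin
        fromℕ n * 0#                    ≈⟨ zeroʳ _ ⟩
        0#                              ≤⟨ Σ-nonneg S₀ (λ j → proj₁ (0≤q≤1 i j)) ⟩
        Σ[ S₀ ] (Q i)                   ≈⟨ Σ-x i ⟨
        fromℕ n * mean (q i) (toList x) ∎))
      small (near-sum i) near-size
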